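{- $S(2,3) = \mathbb{N}_0 \setminus \{1,2,3,5\}$.
   Context: Let $t \le k$ and $v$ be positive integers, $V = \{1,\dots,v\}$, and let $V^k$ be the set of ordered $k$-tuples of elements of $V$. For a $t$-subset $I = \{i_1 < \cdots < i_t\}$ of $\{1,\dots,k\}$ and $(u_1,\dots,u_t) \in V^t$, the tuple $(x_1,\dots,x_k) \in V^k$ is said to contain $(u_1,\dots,u_t)_I$ if $x_{i_j} = u_j$ for all $j = 1,\dots,t$. A $t$-$(v,k)$ Latin trade of volume $s$ is a pair $T = (T_1,T_2)$ of disjoint collections (finite multisets, i.e. repeated elements are allowed; disjoint means no tuple occurs in both), each consisting of $s$ elements of $V^k$ counted with multiplicity, such that for each $t$-subset $I \subseteq \{1,\dots,k\}$ and each $(u_1,\dots,u_t) \in V^t$, the number of elements (with multiplicity) of $T_1$ containing $(u_1,\dots,u_t)_I$ equals the number of elements of $T_2$ containing $(u_1,\dots,u_t)_I$. The trade with $T_1 = T_2 = \emptyset$ (volume $0$) is allowed. The spectrum $S(t,k)$ is the set of all integers $s$ for which there exists, for some $v$, a $t$-$(v,k)$ Latin trade of volume $s$. $\mathbb{N}_0$ denotes the nonnegative integers. -}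

module Defs where

open import Data.Fin using (Fin; _<_; _≟_)
open import Data.Fin.Properties using (all?)
open import Data.List using (List; length; filter)
open import Data.List.Relation.Binary.Disjoint.Propositional using (Disjoint)
open import Data.Nat using (ℕ; NonZero)
open import Data.Product using (_×_; ∃-syntax)
open import Data.Vec using (Vec; lookup)
open import Data.Vec.Relation.Unary.AllPairs using (AllPairs)
open import Level using (0ℓ)
open import Relation.Binary.PropositionalEquality using (_≡_)
open import Relation.Nullary using (Dec)
open import Relation.Unary using (Pred)

-- V^k, with V = {1, …, v} represented by Fin v.
Tuple : ℕ → ℕ → Set
Tuple v k = Vec (Fin v) k

-- A t-subset {i₁ < ⋯ < iₜ} of {1, …, k}, given by its increasing enumeration.
record SubsetOfSize (t k : ℕ) : Set where
  field
    indices    : Vec (Fin k) t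
    increasing : AllPairs _<_ indices

open SubsetOfSize public

Contains : ∀ {t k v} → SubsetOfSize t k → Tuple v t → Pred (Tuple v k) 0ℓ
Contains I u x = ∀ j → lookup x (lookup (indices I) j) ≡ lookup u j

contains? : ∀ {t k v} (I : SubsetOfSize t k) (u : Tuple v t) (x : Tuple v k) →
            Dec (Contains I u x)
contains? I u x = all? λ j → lookup x (lookup (indices I) j) ≟ lookup u j

-- Number of elements, with multiplicity, containing u_I.
count : ∀ {t k v} → SubsetOfSize t k → Tuple v t → List (Tuple v k) → ℕ
count I u T = length (filter (contains? I u) T)

-- Finite multisets are represented by lists; every condition below is
-- invariant under reordering.
record LatinTrade (t v k s : ℕ) : Set where
  field
    T₁ T₂    : List (Tuple v k)
    disjoint : Disjoint T₁ T₂
    volume₁  : length T₁ ≡ s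
    volume₂  : length T₂ ≡ s
    balanced : (I : SubsetOfSize t k) (u : Tuple v t) → count I u T₁ ≡ count I u T₂

-- Only meant for 1 ≤ t ≤ k.  A volume is a cardinality, so the spectrum is a
-- set of natural numbers.
Spectrum : ℕ → ℕ → Pred ℕ 0ℓ
Spectrum t k s = ∃[ v ] NonZero v × LatinTrade t v k s

{-# OPTIONS --safe #-}
module Submission where

-- In a trade T every x ∈ T₁ has, in each of the three directions, a neighbour
-- in T₂ differing from x in exactly that coordinate, and vice versa.  Hence
-- every value that occurs in a given coordinate occurs there in two different
-- elements of T₁, and at least two values occur: a nonempty trade has volume
-- at least 4.  If the volume is less than 6 exactly two values occur in each
-- coordinate, so the trade lives on a cube {x, x′} × {y, y′} × {z, z′}, with T₁
-- on the even vertices and T₂ on the odd ones; neighbours have equal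
-- multiplicity, so 4 divides the volume, which excludes 5.
-- Conversely there are trades of volume 4, 6, 7 and 9 on three symbols such
-- that the first can be superposed on any of them arbitrarily often.

open import Defs
open import Data.Fin using (Fin; punchIn; _<_; _≟_)
open import Data.Fin.Patterns using (0F; 1F; 2F)
open import Data.Fin.Properties using (all?; punchIn-injective; punchInᵢ≢i)
open import Data.List using (List; []; _∷_; _++_; length; filter)
open import Data.List.Membership.Propositional using (_∈_; lose)
open import Data.List.Membership.Propositional.Properties using (∈-filter⁺; ∈-filter⁻; ∈-++⁻)
import Data.List.Relation.Binary.Disjoint.DecPropositional as DecDisjoint
open import Data.List.Relation.Binary.Disjoint.Propositional using (Disjoint)
open import Data.List.Relation.Binary.Disjoint.Propositional.Properties using () renaming (sym to Disjoint-sym)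
open import Data.List.Properties using (filter-++; filter-accept; filter-reject; filter-some; length-++)
open import Data.List.Relation.Unary.All as All using (All; []; _∷_)
open import Data.List.Relation.Unary.AllPairs using ([]; _∷_)
open import Data.List.Relation.Unary.Any using (here; there)
open import Data.List.Relation.Unary.Unique.Propositional using (Unique)
open import Data.Nat as ℕ using (ℕ; suc; _+_; _*_; _≤_; z≤n; s≤s)
open import Data.Nat.Divisibility using (_∣?_; divides)
open import Data.Nat.Properties using (+-suc; +-mono-≤; *-suc; *-comm; <⇒≱; module ≤-Reasoning)
open import Data.Product using (_×_; _,_; proj₁; proj₂; Σ; ∃-syntax; ∃₂)
open import Data.Sum using (_⊎_; inj₁; inj₂; [_,_]′; swap)
open import Data.Vec as Vec using ([]; _∷_; lookup; _[_]≔_)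
open import Data.Vec.Properties using (≡-dec; lookup-map; lookup∘update; lookup∘update′; []≔-lookup)
open import Data.Vec.Relation.Unary.All using ([]; _∷_)
open import Data.Vec.Relation.Unary.AllPairs using ([]; _∷_)
open import Function using (_∘_)
open import Relation.Binary.Definitions using (DecidableEquality)
open import Relation.Binary.PropositionalEquality
open import Relation.Nullary using (Dec; yes; no; ¬_; ¬?; contradiction)
open import Relation.Nullary.Decidable using (True; toWitness; from-no; from-yes)
open import Relation.Unary using (_≐_; _∪_; _∖_; ｛_｝; U; Pred; Decidable)

-- Counting in lists.

module _ {a} {A : Set a} where

  length-filter-split : ∀ {p} {P : Pred A p} (P? : Decidable P) xs →
    length xs ≡ length (filter P? xs) + length (filter (¬? ∘ P?) xs)
  length-filter-split P? []       = refl
  length-filter-split P? (x ∷ xs) with P? x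
  ... | yes _ = cong suc (length-filter-split P? xs)
  ... | no _  = trans (cong suc (length-filter-split P? xs)) (sym (+-suc _ _))

  -- The equivalence is asked for on members only: the predicates compared in `count≡mult` agree
  -- inside `T₁`, not on all tuples.
  filter-cong-∈ : ∀ {p q} {P : Pred A p} {Q : Pred A q} (P? : Decidable P) (Q? : Decidable Q) xs →
    (∀ {x} → x ∈ xs → P x → Q x) → (∀ {x} → x ∈ xs → Q x → P x) → filter P? xs ≡ filter Q? xs
  filter-cong-∈ P? Q? []       _   _   = refl
  filter-cong-∈ P? Q? (x ∷ xs) P⇒Q Q⇒P
    with ih ← filter-cong-∈ P? Q? xs (P⇒Q ∘ there) (Q⇒P ∘ there) | P? x
  ... | yes px = trans (cong (x ∷_) ih) (sym (filter-accept Q? (P⇒Q (here refl) px)))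
  ... | no ¬px = trans ih (sym (filter-reject Q? (¬px ∘ Q⇒P (here refl))))

  filter-filter-⊆ : ∀ {p q} {P : Pred A p} {Q : Pred A q} (P? : Decidable P) (Q? : Decidable Q) →
    (∀ {x} → P x → Q x) → ∀ xs → filter P? (filter Q? xs) ≡ filter P? xs
  filter-filter-⊆ P? Q? P⇒Q []       = refl
  filter-filter-⊆ P? Q? P⇒Q (x ∷ xs) with Q? x
  ... | no ¬qx = trans (filter-filter-⊆ P? Q? P⇒Q xs) (sym (filter-reject P? (¬qx ∘ P⇒Q)))
  ... | yes _  with P? x
  ...   | yes _ = cong (x ∷_) (filter-filter-⊆ P? Q? P⇒Q xs)
  ...   | no _  = filter-filter-⊆ P? Q? P⇒Q xs

  nonempty⇒∈ : ∀ {xs : List A} → 1 ≤ length xs → ∃[ x ] x ∈ xs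
  nonempty⇒∈ {x ∷ _} _ = x , here refl

  module _ {b} {B : Set b} (_≟ᴮ_ : DecidableEquality B) (f : A → B) where

    -- The witnesses differ as elements, not just as positions, so they remain two after filtering.
    Twice : List A → B → Set _
    Twice xs v = ∃₂ λ q r → q ≢ r × (q ∈ xs × f q ≡ v) × (r ∈ xs × f r ≡ v)

    two≤length : ∀ {xs : List A} {q r} → q ≢ r → q ∈ xs → r ∈ xs → 2 ≤ length xs
    two≤length q≢r (here refl) (here refl) = contradiction refl q≢r
    two≤length {_ ∷ _ ∷ _} _ _ _ = s≤s (s≤s z≤n)

    -- Removing the fibre of `f` over `v` costs at least two entries and spares both witnesses of
    -- every other value, since these lie in other fibres.
    twice⇒2*length≤ : ∀ {vs xs} → Unique vs → All (Twice xs) vs → 2 * length vs ≤ length xs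
    twice⇒2*length≤ {[]}     {xs} _         _                                       = z≤n
    twice⇒2*length≤ {v ∷ vs} {xs} (v≢ ∷ uvs) ((q , r , q≢r , (q∈ , fq) , (r∈ , fr)) ∷ tw) = begin
      2 * suc (length vs)
        ≡⟨ *-suc 2 (length vs) ⟩
      2 + 2 * length vs
        ≤⟨ +-mono-≤ (two≤length q≢r (∈-filter⁺ v? q∈ fq) (∈-filter⁺ v? r∈ fr))
                    (twice⇒2*length≤ uvs (All.zipWith outside (v≢ , tw))) ⟩
      length (filter v? xs) + length (filter (¬? ∘ v?) xs)
        ≡⟨ length-filter-split v? xs ⟨
      length xs ∎
      where
      open ≤-Reasoning
      v? : Decidable (λ x → f x ≡ v)
      v? x = f x ≟ᴮ v
      outside : ∀ {w} → v ≢ w × Twice xs w → Twice (filter (¬? ∘ v?) xs) w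
      outside (v≢w , s , t , s≢t , (s∈ , fs) , (t∈ , ft)) = s , t , s≢t
        , (∈-filter⁺ (¬? ∘ v?) s∈ (λ e → v≢w (trans (sym e) fs)) , fs)
        , (∈-filter⁺ (¬? ∘ v?) t∈ (λ e → v≢w (trans (sym e) ft)) , ft)

  module _ (_≟ᴬ_ : DecidableEquality A) where

    multiplicity : A → List A → ℕ
    multiplicity x xs = length (filter (x ≟ᴬ_) xs)

    -- Filtering out `y` removes exactly `m` entries and, by `Unique`, leaves the multiplicities of
    -- the remaining members of `ys` unchanged.
    length-equimultiple : ∀ {m ys xs} → Unique ys → (∀ {x} → x ∈ xs → x ∈ ys) →
      All (λ y → multiplicity y xs ≡ m) ys → length xs ≡ length ys * m
    length-equimultiple {ys = []}     {xs = []}    _ _    _ = refl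
    length-equimultiple {ys = []}     {xs = _ ∷ _} _ xs⊆ _ with () ← xs⊆ (here refl)
    length-equimultiple {m} {y ∷ ys} {xs} (y≢ ∷ uys) xs⊆ (my ∷ mys) =
      trans (length-filter-split (y ≟ᴬ_) xs)
            (cong₂ _+_ my (length-equimultiple uys rest⊆ (All.zipWith rest-multiplicity (y≢ , mys))))
      where
      rest : List A
      rest = filter (¬? ∘ (y ≟ᴬ_)) xs
      rest⊆ : ∀ {x} → x ∈ rest → x ∈ ys
      rest⊆ x∈ with x∈xs , y≢x ← ∈-filter⁻ (¬? ∘ (y ≟ᴬ_)) {xs = xs} x∈ | xs⊆ x∈xs
      ... | here x≡y  = contradiction (sym x≡y) y≢x
      ... | there x∈ys = x∈ys
      rest-multiplicity : ∀ {w} → y ≢ w × multiplicity w xs ≡ m → multiplicity w rest ≡ m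
      rest-multiplicity {w} (y≢w , mw) = trans
        (cong length (filter-filter-⊆ (w ≟ᴬ_) (¬? ∘ (y ≟ᴬ_)) (λ { refl → y≢w }) xs)) mw

-- Neighbours and recurring values.

open LatinTrade

-- Carries lemmas about elements of `T₁` over to elements of `T₂`.
flip : ∀ {t v k s} → LatinTrade t v k s → LatinTrade t v k s
flip T = record
  { T₁ = T₂ T ; T₂ = T₁ T
  ; disjoint = λ (x∈ , y∈) → disjoint T (y∈ , x∈)
  ; volume₁ = volume₂ T ; volume₂ = volume₁ T
  ; balanced = λ I u → sym (balanced T I u) }

restrict : ∀ {t k v} → SubsetOfSize t k → Tuple v k → Tuple v t
restrict I p = Vec.map (lookup p) (indices I)

contains-restrict : ∀ {t k v} (I : SubsetOfSize t k) (p : Tuple v k) → Contains I (restrict I p) p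
contains-restrict I p j = sym (lookup-map j (lookup p) (indices I))

-- The count in `T₁` is positive because of `p` itself; by balance so is the count in `T₂`.
agreeing : ∀ {t v k s} (T : LatinTrade t v k s) {p} → p ∈ T₁ T → (I : SubsetOfSize t k) →
  ∃[ q ] q ∈ T₂ T × Contains I (restrict I p) q
agreeing T {p} p∈ I with q , q∈ ← nonempty⇒∈ (subst (1 ≤_) (balanced T I (restrict I p))
                           (filter-some (contains? I (restrict I p)) (lose p∈ (contains-restrict I p))))
  = q , ∈-filter⁻ (contains? I (restrict I p)) {xs = T₂ T} q∈

-- A 2-subset of three coordinates is named by its complement, the direction in which tuples
-- containing a given pair may still vary.
omit : Fin 3 → SubsetOfSize 2 3
omit i = record { indices = punchIn i 0F ∷ punchIn i 1F ∷ [] ; increasing = (lt i ∷ []) ∷ [] ∷ [] }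
  where
  lt : ∀ i → punchIn i 0F < punchIn i 1F
  lt 0F = s≤s (s≤s z≤n)
  lt 1F = s≤s z≤n
  lt 2F = s≤s z≤n

contains-omit⇒update : ∀ {v} i (p q : Tuple v 3) →
  Contains (omit i) (restrict (omit i) p) q → q ≡ p [ i ]≔ lookup q i
contains-omit⇒update 0F (_ ∷ _ ∷ _ ∷ []) (_ ∷ _ ∷ _ ∷ []) h with refl ← h 0F | refl ← h 1F = refl
contains-omit⇒update 1F (_ ∷ _ ∷ _ ∷ []) (_ ∷ _ ∷ _ ∷ []) h with refl ← h 0F | refl ← h 1F = refl
contains-omit⇒update 2F (_ ∷ _ ∷ _ ∷ []) (_ ∷ _ ∷ _ ∷ []) h with refl ← h 0F | refl ← h 1F = refl

restrict-omit-update : ∀ {v} i (p : Tuple v 3) c → restrict (omit i) (p [ i ]≔ c) ≡ restrict (omit i) p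
restrict-omit-update i p c = cong₂ (λ a b → a ∷ b ∷ [])
  (lookup∘update′ (punchInᵢ≢i i 0F) p c) (lookup∘update′ (punchInᵢ≢i i 1F) p c)

-- The element `q` agreeing with `p` off `i` must differ from it at `i`, or `p` would lie in both
-- halves.
neighbour : ∀ {v s} (T : LatinTrade 2 v 3 s) {p} → p ∈ T₁ T → ∀ i →
  ∃[ c ] c ≢ lookup p i × p [ i ]≔ c ∈ T₂ T
neighbour T {p} p∈ i with q , q∈ , h ← agreeing T p∈ (omit i) =
  lookup q i
    , (λ e → disjoint T
        (p∈ , subst (_∈ T₂ T) (trans q≡ (trans (cong (p [ i ]≔_) e) ([]≔-lookup p i))) q∈))
    , subst (_∈ T₂ T) q≡ q∈
  where
  q≡ = contains-omit⇒update i p q h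

Occurs : ∀ {v s} → LatinTrade 2 v 3 s → Fin 3 → Fin v → Set
Occurs T i a = ∃[ p ] (p ∈ T₁ T ⊎ p ∈ T₂ T) × lookup p i ≡ a

occurs⇒twice : ∀ {v s} (T : LatinTrade 2 v 3 s) i {a} → Occurs T i a →
  Twice _≟_ (λ p → lookup p i) (T₁ T) a
occurs⇒twice T i (p , p∈ , refl) = twice p∈
  where
  j = punchIn i 0F
  k = punchIn i 1F
  i≢j : i ≢ j
  i≢j = ≢-sym (punchInᵢ≢i i 0F)
  i≢k : i ≢ k
  i≢k = ≢-sym (punchInᵢ≢i i 1F)
  j≢k : j ≢ k
  j≢k e with () ← punchIn-injective i 0F 1F e
  twice : p ∈ T₁ T ⊎ p ∈ T₂ T → Twice _≟_ (λ r → lookup r i) (T₁ T) (lookup p i)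
  -- Moving along `j` and then along `k` leads back to `T₁`; coordinate `i` stays fixed, and the
  -- second move does not undo the change at `j`.
  twice (inj₁ p∈)
    with c , c≢ , q∈ ← neighbour T p∈ j
    with d , _ , r∈ ← neighbour (flip T) q∈ k =
    p , (p [ j ]≔ c) [ k ]≔ d
      , (λ e → c≢ (trans (sym (lookup∘update j p c))
                  (trans (sym (lookup∘update′ j≢k (p [ j ]≔ c) d)) (cong (λ r → lookup r j) (sym e)))))
      , (p∈ , refl)
      , (r∈ , trans (lookup∘update′ i≢k (p [ j ]≔ c) d) (lookup∘update′ i≢j p c))
  -- From `T₂` one move reaches each witness; they are distinct because only the first is altered at
  -- `j`.
  twice (inj₂ p∈)
    with c , c≢ , q∈ ← neighbour (flip T) p∈ j
    with d , _ , r∈ ← neighbour (flip T) p∈ k =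
    p [ j ]≔ c , p [ k ]≔ d
      , (λ e → c≢ (trans (sym (lookup∘update j p c))
                  (trans (cong (λ r → lookup r j) e) (lookup∘update′ j≢k p d))))
      , (q∈ , lookup∘update′ i≢j p c)
      , (r∈ , lookup∘update′ i≢k p d)

2*occurring≤volume : ∀ {v s} (T : LatinTrade 2 v 3 s) i {vs} →
  Unique vs → All (Occurs T i) vs → 2 * length vs ≤ s
2*occurring≤volume T i uvs occ = subst (_ ≤_) (volume₁ T)
  (twice⇒2*length≤ _≟_ (λ p → lookup p i) uvs (All.map (occurs⇒twice T i) occ))

occurs-neighbour : ∀ {v s} (T : LatinTrade 2 v 3 s) {p i c} → p [ i ]≔ c ∈ T₂ T → Occurs T i c
occurs-neighbour T {p} {i} {c} q∈ = _ , inj₂ q∈ , lookup∘update i p c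

nonempty⇒4≤volume : ∀ {v s} (T : LatinTrade 2 v 3 s) {p} → p ∈ T₁ T → 4 ≤ s
nonempty⇒4≤volume T {p} p∈ with c , c≢ , q∈ ← neighbour T p∈ 0F =
  2*occurring≤volume T 0F ((≢-sym c≢ ∷ []) ∷ [] ∷ [])
    ((p , inj₁ p∈ , refl) ∷ occurs-neighbour T {p} {0F} q∈ ∷ [])

-- Trades with two values per coordinate.

_≟ᵗ_ : ∀ {v k} → DecidableEquality (Tuple v k)
_≟ᵗ_ = ≡-dec _≟_

mult : ∀ {v k} → Tuple v k → List (Tuple v k) → ℕ
mult = multiplicity _≟ᵗ_

-- Any two distinct occurring values exhaust their coordinate, so no pair has to be fixed in
-- advance.
TwoValued : ∀ {v s} → LatinTrade 2 v 3 s → Set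
TwoValued T = ∀ {i a b c} → a ≢ b → Occurs T i a → Occurs T i b → Occurs T i c → c ≡ a ⊎ c ≡ b

volume<6⇒twoValued : ∀ {v s} (T : LatinTrade 2 v 3 s) → s ℕ.< 6 → TwoValued T
volume<6⇒twoValued T s<6 {i} {a} {b} {c} a≢b oa ob oc with c ≟ a | c ≟ b
... | yes c≡a | _       = inj₁ c≡a
... | no _    | yes c≡b = inj₂ c≡b
-- Three distinct values would force a volume of at least 2 * 3.
... | no c≢a  | no c≢b  = contradiction
  (2*occurring≤volume T i ((c≢a ∷ c≢b ∷ []) ∷ (a≢b ∷ []) ∷ [] ∷ []) (oc ∷ oa ∷ ob ∷ [])) (<⇒≱ s<6)

twoValued-flip : ∀ {v s} (T : LatinTrade 2 v 3 s) → TwoValued T → TwoValued (flip T)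
twoValued-flip T tv a≢b oa ob oc = tv a≢b (back oa) (back ob) (back oc)
  where
  back : ∀ {i a} → Occurs (flip T) i a → Occurs T i a
  back (p , p∈ , e) = p , swap p∈ , e

-- The line through `p` in direction `i` has only one other usable point, the neighbour of `p`. It
-- lies in `T₂`, so all elements of `T₁` on the line are copies of `p`.
count≡mult : ∀ {v s} (T : LatinTrade 2 v 3 s) → TwoValued T → ∀ {p} → p ∈ T₁ T → ∀ i →
  count (omit i) (restrict (omit i) p) (T₁ T) ≡ mult p (T₁ T)
count≡mult T tv {p} p∈ i = cong length
  (filter-cong-∈ (contains? (omit i) (restrict (omit i) p)) (p ≟ᵗ_) (T₁ T) to
    (λ { _ refl → contains-restrict (omit i) p }))
  where
  to : ∀ {q} → q ∈ T₁ T → Contains (omit i) (restrict (omit i) p) q → p ≡ q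
  to {q} q∈ h
    with c , c≢ , r∈ ← neighbour T p∈ i
    with q≡ ← contains-omit⇒update i p q h
    with tv (≢-sym c≢) (p , inj₁ p∈ , refl) (occurs-neighbour T {p} {i} r∈) (q , inj₁ q∈ , refl)
  ... | inj₁ e = sym (trans q≡ (trans (cong (p [ i ]≔_) e) ([]≔-lookup p i)))
  ... | inj₂ e = contradiction (q∈ , subst (_∈ T₂ T) (sym (trans q≡ (cong (p [ i ]≔_) e))) r∈) (disjoint T)

-- Both points lie on the same line in direction `i`; balance on that line equates their
-- multiplicities.
mult-neighbour : ∀ {v s} (T : LatinTrade 2 v 3 s) → TwoValued T → ∀ {p i c} →
  p ∈ T₁ T → p [ i ]≔ c ∈ T₂ T →
  mult (p [ i ]≔ c) (T₂ T) ≡ mult p (T₁ T)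
mult-neighbour T tv {p} {i} {c} p∈ q∈ = begin
  mult (p [ i ]≔ c) (T₂ T)
    ≡⟨ count≡mult (flip T) (twoValued-flip T tv) q∈ i ⟨
  count (omit i) (restrict (omit i) (p [ i ]≔ c)) (T₂ T)
    ≡⟨ cong (λ u → count (omit i) u (T₂ T)) (restrict-omit-update i p c) ⟩
  count (omit i) (restrict (omit i) p) (T₂ T)
    ≡⟨ balanced T (omit i) (restrict (omit i) p) ⟨
  count (omit i) (restrict (omit i) p) (T₁ T)
    ≡⟨ count≡mult T tv p∈ i ⟩
  mult p (T₁ T) ∎
  where open ≡-Reasoning

-- Some neighbour of `p` exists in direction `i`, and `b` is the only value left for it.
update-∈ : ∀ {v s} (T : LatinTrade 2 v 3 s) → TwoValued T →
  ∀ {p} i {b} → p ∈ T₁ T → b ≢ lookup p i → Occurs T i b →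
  p [ i ]≔ b ∈ T₂ T
update-∈ T tv {p} i p∈ b≢ ob with c , c≢ , q∈ ← neighbour T p∈ i
  with tv (≢-sym b≢) (p , inj₁ p∈ , refl) ob (occurs-neighbour T {p} {i} q∈)
... | inj₁ e    = contradiction e c≢
... | inj₂ refl = q∈

twoValued⇒4∣volume : ∀ {v s} (T : LatinTrade 2 v 3 s) → TwoValued T → ∀ {p} → p ∈ T₁ T → ∃[ m ] s ≡ 4 * m
twoValued⇒4∣volume {v} T tv {p@(x ∷ y ∷ z ∷ [])} p∈
  with x′ , x′≢x , o₁ ← neighbour T p∈ 0F
     | y′ , y′≢y , o₂ ← neighbour T p∈ 1F
     | z′ , z′≢z , o₃ ← neighbour T p∈ 2F
  = m , trans (sym (volume₁ T)) (length-equimultiple _≟ᵗ_ unique T₁⊆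
      -- Each even vertex other than `p` is two edges away from `p`, through `o₁` or `o₂`;
      -- multiplicity is preserved along both edges.
      ( refl
      ∷ trans (mult-neighbour T′ tv′ {i = 2F} o₂ e₂) (mult-neighbour T tv {i = 1F} p∈ o₂)
      ∷ trans (mult-neighbour T′ tv′ {i = 2F} o₁ e₃) (mult-neighbour T tv {i = 0F} p∈ o₁)
      ∷ trans (mult-neighbour T′ tv′ {i = 1F} o₁ e₄) (mult-neighbour T tv {i = 0F} p∈ o₁)
      ∷ []))
  where
  m = mult p (T₁ T)
  T′ = flip T
  tv′ = twoValued-flip T tv
  -- Names starting with `e` and `o` mark vertices with an even or odd number of primed coordinates.
  -- The first three odd ones are the neighbours of `p`; the others are reached by further moves
  -- along edges.
  e₂ : x ∷ y′ ∷ z′ ∷ [] ∈ T₁ T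
  e₂ = update-∈ T′ tv′ 2F o₂ z′≢z (_ , inj₁ o₃ , refl)
  e₃ : x′ ∷ y ∷ z′ ∷ [] ∈ T₁ T
  e₃ = update-∈ T′ tv′ 2F o₁ z′≢z (_ , inj₁ o₃ , refl)
  e₄ : x′ ∷ y′ ∷ z ∷ [] ∈ T₁ T
  e₄ = update-∈ T′ tv′ 1F o₁ y′≢y (_ , inj₁ o₂ , refl)
  o₄ : x′ ∷ y′ ∷ z′ ∷ [] ∈ T₂ T
  o₄ = update-∈ T tv 0F e₂ x′≢x (_ , inj₂ o₁ , refl)
  unique : Unique (p ∷ (x ∷ y′ ∷ z′ ∷ []) ∷ (x′ ∷ y ∷ z′ ∷ []) ∷ (x′ ∷ y′ ∷ z ∷ []) ∷ [])
  unique = ((λ { refl → y′≢y refl }) ∷ (λ { refl → x′≢x refl }) ∷ (λ { refl → x′≢x refl }) ∷ [])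
         ∷ ((λ { refl → x′≢x refl }) ∷ (λ { refl → x′≢x refl }) ∷ [])
         ∷ ((λ { refl → y′≢y refl }) ∷ [])
         ∷ [] ∷ []
  values : ∀ {q} → q ∈ T₁ T → ∀ i {c} → c ≢ lookup p i → p [ i ]≔ c ∈ T₂ T →
    lookup q i ≡ lookup p i ⊎ lookup q i ≡ c
  values q∈ i c≢ o∈ = tv (≢-sym c≢) (p , inj₁ p∈ , refl) (occurs-neighbour T {p} {i} o∈) (_ , inj₁ q∈ , refl)
  T₁⊆ : ∀ {q} → q ∈ T₁ T → q ∈ p ∷ (x ∷ y′ ∷ z′ ∷ []) ∷ (x′ ∷ y ∷ z′ ∷ []) ∷ (x′ ∷ y′ ∷ z ∷ []) ∷ []
  T₁⊆ {_ ∷ _ ∷ _ ∷ []} q∈ with values q∈ 0F x′≢x o₁ | values q∈ 1F y′≢y o₂ | values q∈ 2F z′≢z o₃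
  ... | inj₁ refl | inj₁ refl | inj₁ refl = here refl
  ... | inj₁ refl | inj₂ refl | inj₂ refl = there (here refl)
  ... | inj₂ refl | inj₁ refl | inj₂ refl = there (there (here refl))
  ... | inj₂ refl | inj₂ refl | inj₁ refl = there (there (there (here refl)))
  -- The four odd vertices already belong to `T₂`.
  ... | inj₂ refl | inj₁ refl | inj₁ refl = contradiction (q∈ , o₁) (disjoint T)
  ... | inj₁ refl | inj₂ refl | inj₁ refl = contradiction (q∈ , o₂) (disjoint T)
  ... | inj₁ refl | inj₁ refl | inj₂ refl = contradiction (q∈ , o₃) (disjoint T)
  ... | inj₂ refl | inj₂ refl | inj₂ refl = contradiction (q∈ , o₄) (disjoint T)

-- Excluded volumes.

positive⇒4≤ : ∀ {v s} → LatinTrade 2 v 3 (suc s) → 4 ≤ suc s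
positive⇒4≤ T = nonempty⇒4≤volume T (proj₂ (nonempty⇒∈ (subst (1 ≤_) (sym (volume₁ T)) (s≤s z≤n))))

volume≢5 : ∀ {v} → ¬ LatinTrade 2 v 3 5
volume≢5 T with _ , p∈ ← nonempty⇒∈ (subst (1 ≤_) (sym (volume₁ T)) (s≤s z≤n))
  with m , 5≡4m ← twoValued⇒4∣volume T (volume<6⇒twoValued T (from-yes (5 ℕ.<? 6))) p∈
  = from-no (4 ∣? 5) (divides m (trans 5≡4m (*-comm 4 m)))

-- Superposition and verification by decision.

count-++ : ∀ {t k v} (I : SubsetOfSize t k) (u : Tuple v t) xs ys → count I u (xs ++ ys) ≡ count I u xs + count I u ys
count-++ I u xs ys = trans (cong length (filter-++ (contains? I u) xs ys)) (length-++ (filter (contains? I u) xs))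

-- These are the cross terms in the disjointness of a superposition; the other two come from the
-- trades themselves.
Compatible : ∀ {t v k a b} → LatinTrade t v k a → LatinTrade t v k b → Set
Compatible A B = Disjoint (T₁ A) (T₂ B) × Disjoint (T₁ B) (T₂ A)

disjoint-++ˡ : ∀ {a} {A : Set a} {xs ys zs : List A} → Disjoint xs zs → Disjoint ys zs → Disjoint (xs ++ ys) zs
disjoint-++ˡ {xs = xs} xz yz (x∈ , x∈zs) =
  [ (λ x∈xs → xz (x∈xs , x∈zs)) , (λ x∈ys → yz (x∈ys , x∈zs)) ]′ (∈-++⁻ xs x∈)

disjoint-++ʳ : ∀ {a} {A : Set a} {xs ys zs : List A} → Disjoint zs xs → Disjoint zs ys → Disjoint zs (xs ++ ys)
disjoint-++ʳ zx zy = Disjoint-sym (disjoint-++ˡ (Disjoint-sym zx) (Disjoint-sym zy))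

superpose : ∀ {t v k a b} (A : LatinTrade t v k a) (B : LatinTrade t v k b) → Compatible A B → LatinTrade t v k (a + b)
superpose A B (A₁B₂ , B₁A₂) = record
  { T₁ = T₁ A ++ T₁ B
  ; T₂ = T₂ A ++ T₂ B
  ; disjoint = disjoint-++ˡ (disjoint-++ʳ (disjoint A) A₁B₂) (disjoint-++ʳ B₁A₂ (disjoint B))
  ; volume₁ = trans (length-++ (T₁ A)) (cong₂ _+_ (volume₁ A) (volume₁ B))
  ; volume₂ = trans (length-++ (T₂ A)) (cong₂ _+_ (volume₂ A) (volume₂ B))
  ; balanced = λ I u → trans (count-++ I u (T₁ A) (T₁ B))
      (trans (cong₂ _+_ (balanced A I u) (balanced B I u)) (sym (count-++ I u (T₂ A) (T₂ B))))
  }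

-- Compatibility with `A` survives because `A` is compatible with itself, so `A` can be adjoined
-- again.
adjoin : ∀ {t v k a b} (A : LatinTrade t v k a) (B : LatinTrade t v k b) → Compatible A B →
  Σ (LatinTrade t v k (a + b)) (Compatible A)
adjoin A B AB@(A₁B₂ , B₁A₂) =
  superpose A B AB , disjoint-++ʳ (disjoint A) A₁B₂ , disjoint-++ˡ (disjoint A) B₁A₂

-- Replaces the quantifier over subsets, which carry proofs, by finite ones that `balanced?` can
-- decide. Only three pairs of indices are increasing.
balanced-omit⇒balanced : ∀ {v} (xs ys : List (Tuple v 3)) →
  (∀ i a b → count (omit i) (a ∷ b ∷ []) xs ≡ count (omit i) (a ∷ b ∷ []) ys) →
  ∀ (I : SubsetOfSize 2 3) u → count I u xs ≡ count I u ys
balanced-omit⇒balanced _ _ h record { indices = 0F ∷ 1F ∷ [] } (a ∷ b ∷ []) = h 2F a b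
balanced-omit⇒balanced _ _ h record { indices = 0F ∷ 2F ∷ [] } (a ∷ b ∷ []) = h 1F a b
balanced-omit⇒balanced _ _ h record { indices = 1F ∷ 2F ∷ [] } (a ∷ b ∷ []) = h 0F a b
balanced-omit⇒balanced _ _ h record { indices = 0F ∷ 0F ∷ [] ; increasing = (() ∷ []) ∷ _ }
balanced-omit⇒balanced _ _ h record { indices = 1F ∷ 0F ∷ [] ; increasing = (() ∷ []) ∷ _ }
balanced-omit⇒balanced _ _ h record { indices = 1F ∷ 1F ∷ [] ; increasing = (s≤s () ∷ []) ∷ _ }
balanced-omit⇒balanced _ _ h record { indices = 2F ∷ 0F ∷ [] ; increasing = (() ∷ []) ∷ _ }
balanced-omit⇒balanced _ _ h record { indices = 2F ∷ 1F ∷ [] ; increasing = (s≤s () ∷ []) ∷ _ }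
balanced-omit⇒balanced _ _ h record { indices = 2F ∷ 2F ∷ [] ; increasing = (s≤s (s≤s ()) ∷ []) ∷ _ }

disjoint? : ∀ {v k} (xs ys : List (Tuple v k)) → Dec (Disjoint xs ys)
disjoint? = DecDisjoint.disjoint? _≟ᵗ_

balanced? : ∀ {v} (xs ys : List (Tuple v 3)) →
  Dec (∀ i a b → count (omit i) (a ∷ b ∷ []) xs ≡ count (omit i) (a ∷ b ∷ []) ys)
balanced? xs ys = all? λ i → all? λ a → all? λ b →
  count (omit i) (a ∷ b ∷ []) xs ℕ.≟ count (omit i) (a ∷ b ∷ []) ys

trade : ∀ {v} (xs ys : List (Tuple v 3)) {_ : True (disjoint? xs ys)} {_ : True (length ys ℕ.≟ length xs)}
  {_ : True (balanced? xs ys)} → LatinTrade 2 v 3 (length xs)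
trade xs ys {d} {l} {b} = record
  { T₁ = xs ; T₂ = ys
  ; disjoint = toWitness d
  ; volume₁ = refl ; volume₂ = toWitness l
  ; balanced = balanced-omit⇒balanced xs ys (toWitness b) }

compatible : ∀ {v k a b} (A : LatinTrade 2 v k a) (B : LatinTrade 2 v k b)
  {_ : True (disjoint? (T₁ A) (T₂ B))} {_ : True (disjoint? (T₁ B) (T₂ A))} → Compatible A B
compatible A B {p} {q} = toWitness p , toWitness q

-- Explicit trades, read as row, column and symbol of partial Latin squares.

pattern ⟨_,_,_⟩ x y z = x ∷ y ∷ z ∷ []

-- A Latin square of order 2 with its two symbols exchanged.
intercalate : LatinTrade 2 3 3 4
intercalate = trade
  (⟨ 0F , 0F , 0F ⟩ ∷ ⟨ 0F , 1F , 1F ⟩ ∷ ⟨ 1F , 0F , 1F ⟩ ∷ ⟨ 1F , 1F , 0F ⟩ ∷ [])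
  (⟨ 0F , 0F , 1F ⟩ ∷ ⟨ 0F , 1F , 0F ⟩ ∷ ⟨ 1F , 0F , 0F ⟩ ∷ ⟨ 1F , 1F , 1F ⟩ ∷ [])

-- The rows 012 and 120 are exchanged.
six : LatinTrade 2 3 3 6
six = trade
  (⟨ 0F , 0F , 0F ⟩ ∷ ⟨ 0F , 1F , 1F ⟩ ∷ ⟨ 0F , 2F , 2F ⟩
   ∷ ⟨ 1F , 0F , 1F ⟩ ∷ ⟨ 1F , 1F , 2F ⟩ ∷ ⟨ 1F , 2F , 0F ⟩ ∷ [])
  (⟨ 0F , 0F , 1F ⟩ ∷ ⟨ 0F , 1F , 2F ⟩ ∷ ⟨ 0F , 2F , 0F ⟩
   ∷ ⟨ 1F , 0F , 0F ⟩ ∷ ⟨ 1F , 1F , 1F ⟩ ∷ ⟨ 1F , 2F , 2F ⟩ ∷ [])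

-- Row 0 is shifted cyclically from 012 to 201, and the two symbols in each of the other rows are
-- swapped to restore the columns.
seven : LatinTrade 2 3 3 7
seven = trade
  (⟨ 0F , 0F , 0F ⟩ ∷ ⟨ 0F , 1F , 1F ⟩ ∷ ⟨ 0F , 2F , 2F ⟩
   ∷ ⟨ 1F , 0F , 1F ⟩ ∷ ⟨ 1F , 1F , 0F ⟩ ∷ ⟨ 2F , 0F , 2F ⟩
   ∷ ⟨ 2F , 2F , 1F ⟩ ∷ [])
  (⟨ 0F , 0F , 2F ⟩ ∷ ⟨ 0F , 1F , 0F ⟩ ∷ ⟨ 0F , 2F , 1F ⟩
   ∷ ⟨ 1F , 0F , 0F ⟩ ∷ ⟨ 1F , 1F , 1F ⟩ ∷ ⟨ 2F , 0F , 1F ⟩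
   ∷ ⟨ 2F , 2F , 2F ⟩ ∷ [])

-- The cyclic square of order 3 with every symbol lowered by 1 modulo 3. Raising them instead would
-- put `⟨ 1F , 1F , 0F ⟩` into `T₂`, which clashes with `intercalate`.
nine : LatinTrade 2 3 3 9
nine = trade
  (⟨ 0F , 0F , 0F ⟩ ∷ ⟨ 0F , 1F , 1F ⟩ ∷ ⟨ 0F , 2F , 2F ⟩
   ∷ ⟨ 1F , 0F , 1F ⟩ ∷ ⟨ 1F , 1F , 2F ⟩ ∷ ⟨ 1F , 2F , 0F ⟩
   ∷ ⟨ 2F , 0F , 2F ⟩ ∷ ⟨ 2F , 1F , 0F ⟩ ∷ ⟨ 2F , 2F , 1F ⟩ ∷ [])
  (⟨ 0F , 0F , 2F ⟩ ∷ ⟨ 0F , 1F , 0F ⟩ ∷ ⟨ 0F , 2F , 1F ⟩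
   ∷ ⟨ 1F , 0F , 0F ⟩ ∷ ⟨ 1F , 1F , 1F ⟩ ∷ ⟨ 1F , 2F , 2F ⟩
   ∷ ⟨ 2F , 0F , 1F ⟩ ∷ ⟨ 2F , 1F , 2F ⟩ ∷ ⟨ 2F , 2F , 0F ⟩ ∷ [])

-- The volumes 6, 7, 8 and 9 cover all residues modulo 4. Compatibility is carried along so that the
-- induction can add another 4.
volume≥6 : ∀ n → Σ (LatinTrade 2 3 3 (6 + n)) (Compatible intercalate)
volume≥6 0 = six , compatible intercalate six
volume≥6 1 = seven , compatible intercalate seven
volume≥6 2 = adjoin intercalate intercalate (compatible intercalate intercalate)
volume≥6 3 = nine , compatible intercalate nine
volume≥6 (suc (suc (suc (suc n)))) with R , c ← volume≥6 n = adjoin intercalate R c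

proposition3 : Spectrum 2 3 ≐ U ∖ (｛ 1 ｝ ∪ ｛ 2 ｝ ∪ ｛ 3 ｝ ∪ ｛ 5 ｝)
proposition3 = (λ (_ , _ , T) → _ , excluded T) , λ { {s} (_ , s∉) → 3 , _ , construct s s∉ }
  where
  excluded : ∀ {v s} → LatinTrade 2 v 3 s → ¬ (｛ 1 ｝ ∪ ｛ 2 ｝ ∪ ｛ 3 ｝ ∪ ｛ 5 ｝) s
  excluded T (inj₁ refl)                      = from-no (4 ℕ.≤? 1) (positive⇒4≤ T)
  excluded T (inj₂ (inj₁ refl))               = from-no (4 ℕ.≤? 2) (positive⇒4≤ T)
  excluded T (inj₂ (inj₂ (inj₁ refl)))        = from-no (4 ℕ.≤? 3) (positive⇒4≤ T)
  excluded T (inj₂ (inj₂ (inj₂ refl)))        = volume≢5 T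
  construct : ∀ s → ¬ (｛ 1 ｝ ∪ ｛ 2 ｝ ∪ ｛ 3 ｝ ∪ ｛ 5 ｝) s → LatinTrade 2 3 3 s
  construct 0 _  = trade [] []
  construct 1 s∉ = contradiction (inj₁ refl) s∉
  construct 2 s∉ = contradiction (inj₂ (inj₁ refl)) s∉
  construct 3 s∉ = contradiction (inj₂ (inj₂ (inj₁ refl))) s∉
  construct 4 _  = intercalate
  construct 5 s∉ = contradiction (inj₂ (inj₂ (inj₂ refl))) s∉
  construct (suc (suc (suc (suc (suc (suc n)))))) _ = proj₁ (volume≥6 n)
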